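{- The bound $D\le \frac{4n^2}{3m}$ for connected planar graphs is asymptotically tight: for every integer $n\ge 6$ divisible by $3$ there is a finite simple connected planar graph $G_n$ with $n$ vertices such that, writing $m(G_n)$ for its number of edges, $\frac{4n^2}{3\,m(G_n)\,D(G_n)}\to 1$ as $n\to\infty$ (over multiples of $3$).
   Context: $D(G)$ is the diameter of $G$: the maximum over all pairs of vertices of the distance (minimum number of edges on a path) between them. -}

module Defs where

open import Data.Empty using (⊥-elim)
open import Data.Fin using (Fin; zero; suc; fromℕ; inject₁)
import Data.Fin as Fin
import Data.Fin.Properties as Fin
open import Data.Integer using (+_)
open import Data.List using (List; []; _∷_; _∷ʳ_; length; filter; allFin; cartesianProduct)
open import Data.List.Membership.Propositional.Properties
  using (∈-filter⁺; ∈-cartesianProduct⁺; ∈-allFin; ∈-length)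
open import Data.Nat using (ℕ; zero; suc; _*_; _^_; _≤_; _<_; z≤n; s≤s; NonZero; >-nonZero)
open import Data.Nat.Properties using (m*n≢0)
open import Data.Product using (∃; ∃-syntax; ∃₂; _×_; _,_)
open import Data.Rational using (ℚ; 0ℚ; 1ℚ; _/_)
import Data.Rational as ℚ
open import Data.Sum using (_⊎_)
open import Data.Unit using (⊤)
open import Function.Definitions using (Injective)
open import Level using (0ℓ)
open import Relation.Binary using (Rel; Decidable; Symmetric; Irreflexive; tri<; tri≈; tri>)
open import Relation.Binary.PropositionalEquality
  using (_≡_; _≢_; refl; sym; trans)
open import Relation.Nullary using (Dec)
open import Relation.Nullary.Decidable using (_×-dec_)

record Graph (n : ℕ) : Set₁ where
  field
    _~_    : Rel (Fin n) 0ℓ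
    _~?_   : Decidable _~_
    symm   : Symmetric _~_
    irrefl : Irreflexive _≡_ _~_

module _ {n : ℕ} (G : Graph n) where
  open Graph G

  -- Each undirected edge is represented once, by its increasing pair of ends.
  IsEdge : Fin n × Fin n → Set
  IsEdge (u , v) = u Fin.< v × u ~ v

  isEdge? : (e : Fin n × Fin n) → Dec (IsEdge e)
  isEdge? (u , v) = (u Fin.<? v) ×-dec (u ~? v)

  edges : List (Fin n × Fin n)
  edges = filter isEdge? (cartesianProduct (allFin n) (allFin n))

  edgeCount : ℕ
  edgeCount = length edges

  record Path (u v : Fin n) (k : ℕ) : Set where
    field
      vertex   : Fin (suc k) → Fin n
      start    : vertex zero ≡ u
      end      : vertex (fromℕ k) ≡ v
      step     : ∀ i → vertex (inject₁ i) ~ vertex (suc i)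
      distinct : Injective _≡_ _≡_ vertex

  Connected : Set
  Connected = ∀ u v → ∃[ k ] Path u v k

IsMinimum IsMaximum : (ℕ → Set) → ℕ → Set
IsMinimum P k = P k × (∀ j → P j → k ≤ j)
IsMaximum P k = P k × (∀ j → P j → j ≤ k)

module _ {n : ℕ} (G : Graph n) where

  IsDistance : Fin n → Fin n → ℕ → Set
  IsDistance u v = IsMinimum (Path G u v)

  IsDiameter : ℕ → Set
  IsDiameter = IsMaximum (λ k → ∃₂ λ u v → IsDistance u v k)

-- Plane drawings use polygonal arcs.  The coordinates are rational, and so are
-- the points at which arcs are tested for crossings.  The latter loses nothing:
-- two segments with rational ends that meet in the real plane meet in a rational
-- point, and if they share two real points they share two rational ones.

Point : Set
Point = ℚ × ℚ

between : ℚ → Point → Point → Point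
between t (x , y) (x′ , y′) = mix x x′ , mix y y′
  where
  mix : ℚ → ℚ → ℚ
  mix a b = (1ℚ ℚ.- t) ℚ.* a ℚ.+ t ℚ.* b

OnSegment : Point → Point → Point → Set
OnSegment a b p = ∃[ t ] (0ℚ ℚ.≤ t × t ℚ.≤ 1ℚ × p ≡ between t a b)

-- The polygonal line starting at the first argument and visiting the listed
-- points in order.
OnLine : Point → List Point → Point → Set
OnLine a []       p = p ≡ a
OnLine a (b ∷ bs) p = OnSegment a b p ⊎ OnLine b bs p

-- The polygonal line has no self-intersection.
IsArc : Point → List Point → Set
IsArc a []       = ⊤
IsArc a (b ∷ bs) =
  a ≢ b × (∀ p → OnSegment a b p → OnLine b bs p → p ≡ b) × IsArc b bs

record PlaneDrawing {n : ℕ} (G : Graph n) : Set where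
  field
    position : Fin n → Point
    -- Interior corners of the arc of an edge; irrelevant at non-edges.
    bends    : Fin n × Fin n → List Point

  OnEdge : Fin n × Fin n → Point → Set
  OnEdge (u , v) = OnLine (position u) (bends (u , v) ∷ʳ position v)

  IsEnd : Fin n × Fin n → Point → Set
  IsEnd (u , v) p = p ≡ position u ⊎ p ≡ position v

  field
    positions-distinct : Injective _≡_ _≡_ position
    edges-arcs : ∀ u v → IsEdge G (u , v) →
      IsArc (position u) (bends (u , v) ∷ʳ position v)
    -- The interior of an edge contains no vertex and no point of another edge.
    interior-no-vertex : ∀ e → IsEdge G e →
      ∀ w → OnEdge e (position w) → IsEnd e (position w)
    interior-no-crossing : ∀ e e′ → IsEdge G e → IsEdge G e′ → e ≢ e′ →
      ∀ p → OnEdge e p → OnEdge e′ p → IsEnd e p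

Planar : ∀ {n} → Graph n → Set
Planar = PlaneDrawing

record ConnectedPlanarGraph (n : ℕ) : Set₁ where
  field
    graph     : Graph n
    connected : Connected graph
    planar    : Planar graph

module _ {n : ℕ} (G : Graph n) where
  open Graph G

  someAdjacent : 1 < n → Connected G → ∃₂ λ u v → u ~ v
  someAdjacent (s≤s (s≤s _)) conn with conn zero (suc zero)
  ... | zero , p with trans (sym (Path.start p)) (Path.end p)
  ...   | ()
  someAdjacent (s≤s (s≤s _)) conn | suc k , p = _ , _ , Path.step p zero

  edgeCount-nonZero : 1 < n → Connected G → NonZero (edgeCount G)
  edgeCount-nonZero 1<n conn with someAdjacent 1<n conn
  ... | u , v , u~v with Fin.<-cmp u v
  ...   | tri< u<v _ _ = >-nonZero (∈-length
            (∈-filter⁺ (isEdge? G) (∈-cartesianProduct⁺ (∈-allFin u) (∈-allFin v)) (u<v , u~v)))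
  ...   | tri≈ _ u≡v _ = ⊥-elim (irrefl u≡v u~v)
  ...   | tri> _ _ v<u = >-nonZero (∈-length
            (∈-filter⁺ (isEdge? G) (∈-cartesianProduct⁺ (∈-allFin v) (∈-allFin u)) (v<u , symm u~v)))

  adjacent-distance : ∀ {u v} → u ~ v → IsDistance G u v 1
  adjacent-distance {u} {v} u~v = path , minimal
    where
    vertex : Fin 2 → Fin n
    vertex zero       = u
    vertex (suc zero) = v

    distinct : Injective _≡_ _≡_ vertex
    distinct {zero}     {zero}     _  = refl
    distinct {zero}     {suc zero} eq = ⊥-elim (irrefl eq u~v)
    distinct {suc zero} {zero}     eq = ⊥-elim (irrefl (sym eq) u~v)
    distinct {suc zero} {suc zero} _  = refl

    path : Path G u v 1
    path = record
      { vertex = vertex ; start = refl ; end = refl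
      ; step = λ { zero → u~v } ; distinct = distinct }

    minimal : ∀ j → Path G u v j → 1 ≤ j
    minimal zero    p = ⊥-elim (irrefl (trans (sym (Path.start p)) (Path.end p)) u~v)
    minimal (suc j) p = s≤s z≤n

  diameter-nonZero : 1 < n → Connected G → ∀ {D} → IsDiameter G D → NonZero D
  diameter-nonZero 1<n conn (_ , max) with someAdjacent 1<n conn
  ... | u , v , u~v = >-nonZero (max 1 (u , v , adjacent-distance u~v))

  3mD-nonZero : 1 < n → Connected G → ∀ {D} → IsDiameter G D →
    NonZero (3 * edgeCount G * D)
  3mD-nonZero 1<n conn {D} diam =
    m*n≢0 (3 * edgeCount G) D {{m*n≢0 3 (edgeCount G) {{_}} {{edgeCount-nonZero 1<n conn}}}}
      {{diameter-nonZero 1<n conn diam}}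

ratio : ∀ {n} → 1 < n → (G : ConnectedPlanarGraph n) →
  ∃ (IsDiameter (ConnectedPlanarGraph.graph G)) → ℚ
ratio {n} 1<n G (D , diam) =
  _/_ (+ (4 * n ^ 2)) (3 * edgeCount graph * D) {{3mD-nonZero graph 1<n connected diam}}
  where open ConnectedPlanarGraph G

{-# OPTIONS --safe #-}

-- Take a path on the vertices 0, …, p and continue it by the cube of a path on the
-- vertices p, …, n-1.  Up to bounded errors this graph has p + 3(n-p) edges and
-- diameter p + (n-p)/3; the product of the two is largest at p = n/2, where it is
-- 4n²/3.  For a plane drawing put vertex i at distance i+1 from the origin on one of
-- three rays, the tail on the first ray and the cube cyclically on all three.  The
-- straight edges then either join consecutive vertices of one ray or zigzag outwards
-- between two rays, so none of them cross.
module Submission where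

open import Defs
open import Data.Empty using (⊥)
open import Data.Fin using (Fin; zero; suc; toℕ; fromℕ; fromℕ<; inject₁; opposite)
import Data.Fin as Fin
import Data.Fin.Properties as Fin
open import Data.Fin.Properties
  using (toℕ-injective; toℕ-fromℕ; toℕ-fromℕ<; toℕ<n; opposite-involutive; injective⇒≤)
open import Data.Integer using (+_; +[1+_]; +<+; +≤+)
import Data.Integer as ℤ
import Data.Integer.Properties as ℤ
open import Data.List using (List; []; _∷_; _++_; length; map; lookup; upTo; allFin; cartesianProduct)
open import Data.List.Membership.Propositional using (_∈_)
open import Data.List.Membership.Propositional.Properties
  using (∈-map⁺; ∈-map⁻; ∈-++⁺ˡ; ∈-++⁺ʳ; ∈-++⁻; ∈-upTo⁺; ∈-upTo⁻; ∈-lookup;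
         ∈-filter⁺; ∈-filter⁻; ∈-cartesianProduct⁺; ∈-allFin)
import Data.List.Membership.Setoid.Properties as Membershipₛ
open import Data.List.Properties using (length-map; length-++; length-upTo)
open import Data.List.Relation.Binary.Disjoint.Propositional using (Disjoint)
open import Data.List.Relation.Binary.Subset.Propositional using (_⊆_)
import Data.List.Relation.Unary.All as All
open import Data.List.Relation.Unary.AllPairs using (_∷_)
open import Data.List.Relation.Unary.Unique.Propositional using (Unique)
import Data.List.Relation.Unary.Unique.Propositional.Properties as Unique
open import Data.Nat
open import Data.Nat.Divisibility using (_∣_; divides; quotient)
open import Data.Nat.Induction using (<-wellFounded)
open import Data.Nat.Properties
open import Data.Nat.Tactic.RingSolver using (solve-∀)
open import Data.Product using (Σ-syntax; ∃; ∃-syntax; _×_; _,_; proj₁; proj₂)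
open import Data.Rational using (ℚ; mkℚ; 0ℚ; 1ℚ; ↧ₙ_; *<*)
import Data.Rational as ℚ
import Data.Rational.Properties as ℚ
open import Data.Rational.Solver using (module +-*-Solver)
open import Data.Rational.Unnormalised using (mkℚᵘ; *<*; *≤*)
import Data.Rational.Unnormalised as ℚᵘ
import Data.Rational.Unnormalised.Properties as ℚᵘ
open import Data.Sum using (_⊎_; inj₁; inj₂; [_,_]′; swap)
import Data.Sum as Sum
open import Data.Unit using (tt)
open import Function using (_∘_; _$_; id)
open import Induction.WellFounded using (Acc; acc)
open import Relation.Binary using (Tri; tri<; tri≈; tri>)
open import Relation.Binary.PropositionalEquality
open import Relation.Nullary using (Dec; yes; no; contradiction)
open import Relation.Nullary.Decidable using (toWitness; ¬?; _×-dec_; _⊎-dec_)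

-- Paths

-- Why the optimum is at one half: if the cube part has `x` vertices, three times the product of
-- edge count and diameter is about `(p + 3x)(3p + x)`. The two factors add up to `4n`, so the
-- product is at most `4n²`, with equality for `p = x`. Planarity becomes arithmetic because `plane`
-- is injective on nonnegative triples with a zero entry, and a straight segment between rays keeps
-- such an entry. A common point of two edges therefore yields three scalar equations. What remains
-- is that chords over the same two rays never interleave: they have equal length or, when they run
-- in opposite directions, lengths adding up to three, the least gap between cube vertices on one
-- ray.

module _ {n : ℕ} {G : Graph n} where
  open Graph G
  open Path

  trivialPath : ∀ {u} → Path G u u 0
  trivialPath {u} = record
    { vertex = λ _ → u ; start = refl ; end = refl ; step = λ ()
    ; distinct = λ { {zero} {zero} _ → refl } }

  consPath : ∀ {u v w k} → u ~ w → (P : Path G w v k) → (∀ i → vertex P i ≢ u) →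
    Path G u v (suc k)
  consPath {u} {v} {w} {k} u~w P fresh = record
    { vertex = vertex′ ; start = refl ; end = end P ; step = step′ ; distinct = distinct′ }
    where
    vertex′ : Fin (suc (suc k)) → Fin n
    vertex′ zero    = u
    vertex′ (suc i) = vertex P i

    step′ : ∀ i → vertex′ (inject₁ i) ~ vertex′ (suc i)
    step′ zero    = subst (u ~_) (sym (start P)) u~w
    step′ (suc i) = step P i

    distinct′ : ∀ {i j} → vertex′ i ≡ vertex′ j → i ≡ j
    distinct′ {zero}  {zero}  _  = refl
    distinct′ {zero}  {suc j} eq = contradiction (sym eq) (fresh j)
    distinct′ {suc i} {zero}  eq = contradiction eq (fresh i)
    distinct′ {suc i} {suc j} eq = cong suc (distinct P eq)

  private
    opposite-fromℕ : ∀ k → opposite (fromℕ k) ≡ zero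
    opposite-fromℕ zero    = refl
    opposite-fromℕ (suc k) = cong inject₁ (opposite-fromℕ k)

    opposite-inject₁ : ∀ {k} (i : Fin k) → opposite (inject₁ i) ≡ suc (opposite i)
    opposite-inject₁ zero    = refl
    opposite-inject₁ (suc i) = cong inject₁ (opposite-inject₁ i)

  reversePath : ∀ {u v k} → Path G u v k → Path G v u k
  reversePath {k = k} P = record
    { vertex   = vertex P ∘ opposite
    ; start    = end P
    ; end      = trans (cong (vertex P) (opposite-fromℕ k)) (start P)
    ; step     = λ i → subst (λ j → vertex P j ~ vertex P (inject₁ (opposite i)))
                         (sym (opposite-inject₁ i)) (symm (step P (opposite i)))
    ; distinct = λ {i} {j} eq → trans (sym (opposite-involutive i))
                   (trans (cong opposite (distinct P eq)) (opposite-involutive j)) }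

  -- Telescoping along the path. With `level` as the potential this supplies the lower bound on the
  -- diameter.
  potential-≤-length : (f : Fin n → ℕ) → (∀ {u v} → u ~ v → f u ≤ suc (f v)) →
    ∀ {u v k} → Path G u v k → f u ≤ k + f v
  potential-≤-length f drop P =
    subst₂ (λ x y → f x ≤ _ + f y) (start P) (end P) (along _ (vertex P) (step P))
    where
    along : ∀ k (x : Fin (suc k) → Fin n) → (∀ i → x (inject₁ i) ~ x (suc i)) →
      f (x zero) ≤ k + f (x (fromℕ k))
    along zero    x st = ≤-refl
    along (suc k) x st = ≤-trans (drop (st zero)) (s≤s (along k (x ∘ suc) (st ∘ suc)))

-- The path 0 ─ 1 ─ ⋯ ─ p followed by the cube of a path on the vertices ≥ p;
-- Near is oriented, from the smaller end to the larger.
Near : ℕ → ℕ → ℕ → Set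
Near p i j = j ≡ 1 + i ⊎ (p ≤ i × (j ≡ 2 + i ⊎ j ≡ 3 + i))

near? : ∀ p i j → Dec (Near p i j)
near? p i j = (j ≟ 1 + i) ⊎-dec ((p ≤? i) ×-dec ((j ≟ 2 + i) ⊎-dec (j ≟ 3 + i)))

near⇒< : ∀ {p i j} → Near p i j → i < j
near⇒< (inj₁ refl)              = ≤-refl
near⇒< (inj₂ (_ , inj₁ refl))   = m≤n⇒m≤1+n ≤-refl
near⇒< (inj₂ (_ , inj₂ refl))   = m≤n⇒m≤1+n (m≤n⇒m≤1+n ≤-refl)

near⇒≤3+ : ∀ {p i j} → Near p i j → j ≤ 3 + i
near⇒≤3+ {i = i} (inj₁ refl)            = +-monoˡ-≤ i (s≤s z≤n)
near⇒≤3+ {i = i} (inj₂ (_ , inj₁ refl)) = +-monoˡ-≤ i (s≤s (s≤s z≤n))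
near⇒≤3+         (inj₂ (_ , inj₂ refl)) = ≤-refl

≤3+⇒near : ∀ {p i j} → p ≤ i → i < j → j ≤ 3 + i → Near p i j
≤3+⇒near {p} {i} p≤i i<j j≤3+i with m≤n⇒∃[o]m+o≡n i<j
... | 0 , refl = inj₁ (cong suc (+-identityʳ i))
... | 1 , refl = inj₂ (p≤i , inj₁ (cong suc (+-comm i 1)))
... | 2 , refl = inj₂ (p≤i , inj₂ (cong suc (+-comm i 2)))
... | suc (suc (suc o)) , refl =
  contradiction (subst (_≤ 2 + i) (+-comm i (3 + o)) (≤-pred j≤3+i))
    (<⇒≱ (+-monoˡ-≤ i (s≤s (s≤s (s≤s z≤n)))))

tailedCube : ℕ → ∀ n → Graph n
tailedCube p n = record
  { _~_    = λ u v → Near p (toℕ u) (toℕ v) ⊎ Near p (toℕ v) (toℕ u)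
  ; _~?_   = λ u v → near? p (toℕ u) (toℕ v) ⊎-dec near? p (toℕ v) (toℕ u)
  ; symm   = swap
  ; irrefl = λ { refl (inj₁ e) → <-irrefl refl (near⇒< {p} e)
               ; refl (inj₂ e) → <-irrefl refl (near⇒< {p} e) } }

tailedCube-edge⁻ : ∀ {p n u v} → IsEdge (tailedCube p n) (u , v) → Near p (toℕ u) (toℕ v)
tailedCube-edge⁻         (u<v , inj₁ e) = e
tailedCube-edge⁻ {p = p} (u<v , inj₂ e) = contradiction (near⇒< {p} e) (<-asym u<v)

-- Distances

⌈_/3⌉ : ℕ → ℕ
⌈ 0 /3⌉                 = 0
⌈ 1 /3⌉                 = 1
⌈ 2 /3⌉                 = 1
⌈ suc (suc (suc n)) /3⌉ = suc ⌈ n /3⌉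

⌈/3⌉-mono : ∀ {m n} → m ≤ n → ⌈ m /3⌉ ≤ ⌈ n /3⌉
⌈/3⌉-mono {0} _ = z≤n
⌈/3⌉-mono {1} {1} _ = ≤-refl
⌈/3⌉-mono {1} {2} _ = ≤-refl
⌈/3⌉-mono {1} {suc (suc (suc n))} _ = s≤s z≤n
⌈/3⌉-mono {2} {1} (s≤s ())
⌈/3⌉-mono {2} {2} _ = ≤-refl
⌈/3⌉-mono {2} {suc (suc (suc n))} _ = s≤s z≤n
⌈/3⌉-mono {suc (suc (suc m))} {suc (suc (suc n))} (s≤s (s≤s (s≤s le))) = s≤s (⌈/3⌉-mono le)

-- The distance from vertex 0 to vertex `i`: `i ⊓ p` steps along the tail, then strides of three
-- through the cube. Truncated subtraction removes the second term on the tail.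
level : ℕ → ℕ → ℕ
level p i = i ⊓ p + ⌈ i ∸ p /3⌉

level-mono : ∀ p {i j} → i ≤ j → level p i ≤ level p j
level-mono p le = +-mono-≤ (⊓-monoˡ-≤ p le) (⌈/3⌉-mono (∸-monoˡ-≤ p le))

level-tail : ∀ {p i} → i ≤ p → level p i ≡ i
level-tail i≤p rewrite m≤n⇒m⊓n≡m i≤p | m≤n⇒m∸n≡0 i≤p = +-identityʳ _

level-cube : ∀ p i → level p (i + p) ≡ p + ⌈ i /3⌉
level-cube p i rewrite m≥n⇒m⊓n≡n (m≤n+m p i) | m+n∸n≡m i p = refl

-- In the cube `⌈_/3⌉` rises by one when its argument grows by three; in the tail only unit steps
-- occur. The junction `p` satisfies both case hypotheses, so the tail case has to deal with it
-- again.
level-near : ∀ {p i j} → Near p i j → level p j ≤ suc (level p i)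
level-near {p} {i} near with ≤-total p i
level-near {p} {i} {j} near | inj₁ p≤i with m≤n⇒∃[o]m+o≡n p≤i
... | o , refl rewrite +-comm p o | level-cube p o = begin
  level p j             ≤⟨ level-mono p (near⇒≤3+ {p} near) ⟩
  level p (3 + o + p)   ≡⟨ level-cube p (3 + o) ⟩
  p + suc ⌈ o /3⌉       ≡⟨ +-suc p _ ⟩
  suc (p + ⌈ o /3⌉)     ∎
  where open ≤-Reasoning
level-near {p} {i} (inj₁ refl) | inj₂ i≤p rewrite level-tail i≤p with m≤n⇒m<n∨m≡n i≤p
... | inj₁ i<p  = ≤-reflexive (level-tail i<p)
... | inj₂ refl = ≤-reflexive (trans (level-cube i 1) (+-comm i 1))
level-near {p} {i} {j} (inj₂ (p≤i , e)) | inj₂ i≤p rewrite ≤-antisym i≤p p≤i = begin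
  level p j             ≤⟨ level-mono p (near⇒≤3+ {p} {p} {j} (inj₂ (≤-refl , e))) ⟩
  level p (3 + p)       ≡⟨ level-cube p 3 ⟩
  p + 1                 ≡⟨ +-comm p 1 ⟩
  suc p                 ≡⟨ cong suc (level-tail {p} ≤-refl) ⟨
  suc (level p p)       ∎
  where open ≤-Reasoning

-- In the tail the parent is `v - 1`; in the cube it is `v - 3`, but never below `p`. The last
-- component lets a descent aimed at an arbitrary `u` stop exactly there instead of stepping over
-- it.
parent : ∀ p v → 0 < v →
  ∃[ w ] w < v × suc (level p w) ≤ level p v × (∀ u → w ≤ u → u < v → Near p u v)
parent p (suc v) _ with suc v ≤? p
... | yes v<p = v , ≤-refl , ≤-reflexive (trans (cong suc (level-tail (<⇒≤ v<p))) (sym (level-tail v<p))) ,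
  λ u v≤u u<1+v → inj₁ (cong suc (≤-antisym v≤u (≤-pred u<1+v)))
... | no v≮p with m≤n⇒∃[o]m+o≡n (≰⇒> v≮p)
...   | o , eq rewrite trans (sym eq) (cong suc (+-comm p o)) = cubeParent o
  where
  cubeParent : ∀ o → ∃[ w ] w < suc o + p × suc (level p w) ≤ level p (suc o + p) ×
    (∀ u → w ≤ u → u < suc o + p → Near p u (suc o + p))
  cubeParent (suc (suc o)) = o + p , m≤n⇒m≤1+n (n≤1+n _) ,
    ≤-reflexive (trans (cong suc (level-cube p o)) (sym (trans (level-cube p (3 + o)) (+-suc p _)))) ,
    λ u w≤u u<v → ≤3+⇒near (≤-trans (m≤n+m p o) w≤u) u<v (+-monoʳ-≤ 3 w≤u)
  cubeParent 0 = p , n<1+n p ,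
    ≤-reflexive (trans (cong suc (level-tail {p} ≤-refl)) (sym (trans (level-cube p 1) (+-comm p 1)))) ,
    λ u p≤u u<v → ≤3+⇒near p≤u u<v (+-mono-≤ {1} {3} (s≤s z≤n) p≤u)
  cubeParent 1 = p , m≤n⇒m≤1+n (n<1+n p) ,
    ≤-reflexive (trans (cong suc (level-tail {p} ≤-refl)) (sym (trans (level-cube p 2) (+-comm p 1)))) ,
    λ u p≤u u<v → ≤3+⇒near p≤u u<v (+-mono-≤ {2} {3} (s≤s (s≤s z≤n)) p≤u)

module _ {p n : ℕ} where
  private G = tailedCube p n
  open Path

  -- Each passage to the parent costs at least one level, so the level of the upper end bounds the
  -- length whatever the target is; the diameter needs nothing sharper. The bound on the vertices
  -- keeps the next vertex fresh, so that the walk is a path.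
  descend : ∀ {u v : Fin n} → u Fin.≤ v →
    ∃[ k ] Σ[ P ∈ Path G v u k ] k ≤ level p (toℕ v) × (∀ i → vertex P i Fin.≤ v)
  descend = go (<-wellFounded _)
    where
    go : ∀ {u v : Fin n} → Acc _<_ (toℕ v) → u Fin.≤ v →
      ∃[ k ] Σ[ P ∈ Path G v u k ] k ≤ level p (toℕ v) × (∀ i → vertex P i Fin.≤ v)
    go {u} {v} (acc rs) u≤v with m≤n⇒m<n∨m≡n u≤v
    ... | inj₂ u≡v rewrite toℕ-injective u≡v = 0 , trivialPath , z≤n , λ _ → ≤-refl
    ... | inj₁ u<v with parent p (toℕ v) (≤-trans (s≤s z≤n) u<v)
    ...   | w , w<v , rise , nbrs with ≤-total w (toℕ u)
    -- The target lies between the parent and `v`, so one edge ends the descent; `rise` shows that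
    -- `v` has positive level.
    ...     | inj₁ w≤u = 1 ,
      consPath (inj₂ (nbrs (toℕ u) w≤u u<v)) trivialPath (λ _ u≡v → <-irrefl (cong toℕ u≡v) u<v) ,
      ≤-trans (s≤s z≤n) rise , λ { zero → ≤-refl ; (suc _) → <⇒≤ u<v }
    ...     | inj₂ u≤w =
      let w<n  = <-trans w<v (toℕ<n v)
          w′≡w = toℕ-fromℕ< w<n
          w′<v = subst (_< toℕ v) (sym w′≡w) w<v
          k , P , k≤ , below = go {u} {fromℕ< w<n} (rs w′<v) (subst (toℕ u ≤_) (sym w′≡w) u≤w)
          below′ = λ i → ≤-<-trans (below i) w′<v
      in suc k ,
         consPath (inj₂ (subst (λ x → Near p x (toℕ v)) (sym w′≡w) (nbrs w ≤-refl w<v))) P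
           (λ i eq → <-irrefl (cong toℕ eq) (below′ i)) ,
         ≤-trans (s≤s (subst (λ x → k ≤ level p x) w′≡w k≤)) rise ,
         λ { zero → ≤-refl ; (suc i) → <⇒≤ (below′ i) }

  tailedCube-connected : Connected G
  tailedCube-connected u v with ≤-total (toℕ u) (toℕ v)
  ... | inj₁ u≤v = let k , P , _ = descend u≤v in k , reversePath P
  ... | inj₂ v≤u = let k , P , _ = descend v≤u in k , P

  level-drop : ∀ {u v : Fin n} → Graph._~_ G u v → level p (toℕ u) ≤ suc (level p (toℕ v))
  level-drop (inj₁ e) = m≤n⇒m≤1+n (level-mono p (<⇒≤ (near⇒< {p} e)))
  level-drop (inj₂ e) = level-near e

-- The two ends of the graph are an extreme pair: `descend` bounds every distance by the level of
-- the larger vertex, and the potential `level`, which is 0 at `zero`, shows that the last vertex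
-- attains this bound.
tailedCube-diameter : ∀ p n → IsDiameter (tailedCube p (suc n)) (level p n)
tailedCube-diameter p n = (fromℕ n , zero , attained) , bounded
  where
  G = tailedCube p (suc n)

  lower : ∀ j → Path G (fromℕ n) zero j → level p n ≤ j
  lower j P with potential-≤-length (λ v → level p (toℕ v)) level-drop P
  ... | le rewrite toℕ-fromℕ n | level-tail {p} z≤n | +-identityʳ j = le

  attained : IsDistance G (fromℕ n) zero (level p n)
  attained with descend {p} {u = zero} {v = fromℕ n} z≤n
  ... | k , P , k≤ , _ = subst (IsDistance G (fromℕ n) zero)
    (≤-antisym (subst (λ x → k ≤ level p x) (toℕ-fromℕ n) k≤) (lower k P))
    (P , λ j Q → ≤-trans (subst (λ x → k ≤ level p x) (toℕ-fromℕ n) k≤) (lower j Q))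

  bounded : ∀ j → (∃[ u ] ∃[ v ] IsDistance G u v j) → j ≤ level p n
  bounded j (u , v , _ , minimal) with ≤-total (toℕ u) (toℕ v)
  ... | inj₁ u≤v = let k , P , k≤ , _ = descend u≤v in
    ≤-trans (minimal k (reversePath P)) (≤-trans k≤ (level-mono p (≤-pred (toℕ<n v))))
  ... | inj₂ v≤u = let k , P , k≤ , _ = descend v≤u in
    ≤-trans (minimal k P) (≤-trans k≤ (level-mono p (≤-pred (toℕ<n u))))

-- Number of edges

module _ {a} {A : Set a} where

  lookup-injective : ∀ {xs : List A} → Unique xs → ∀ {i j} → lookup xs i ≡ lookup xs j → i ≡ j
  lookup-injective (_ ∷ _)  {zero}  {zero}  _  = refl
  lookup-injective (x∉ ∷ _) {zero}  {suc j} eq = contradiction eq (All.lookup x∉ (∈-lookup j))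
  lookup-injective (x∉ ∷ _) {suc i} {zero}  eq = contradiction (sym eq) (All.lookup x∉ (∈-lookup i))
  lookup-injective (_ ∷ xs!) {suc i} {suc j} eq = cong suc (lookup-injective xs! eq)

  unique-⊆⇒length-≤ : ∀ {xs ys : List A} → Unique xs → xs ⊆ ys → length xs ≤ length ys
  unique-⊆⇒length-≤ xs! xs⊆ys = injective⇒≤ λ {i} {j} eq → lookup-injective xs!
    (Membershipₛ.index-injective (setoid A) (xs⊆ys (∈-lookup i)) (xs⊆ys (∈-lookup j)) eq)

private
  shifts : ℕ → ℕ → ℕ → List (ℕ × ℕ)
  shifts p d m = map (λ i → i + p , d + (i + p)) (upTo m)

  shifts-unique : ∀ p d m → Unique (shifts p d m)
  shifts-unique p d m = Unique.map⁺ (λ eq → +-cancelʳ-≡ p _ _ (cong proj₁ eq)) (Unique.upTo⁺ m)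

  ∈-shifts⁻ : ∀ p d m {i j} → (i , j) ∈ shifts p d m → p ≤ i × i < m + p × j ≡ d + i
  ∈-shifts⁻ p d m e with ∈-map⁻ _ e
  ... | o , o∈ , refl = m≤n+m p o , +-monoˡ-< p (∈-upTo⁻ o∈) , refl

  ∈-shifts⁺ : ∀ p d m {i} → p ≤ i → i < m + p → (i , d + i) ∈ shifts p d m
  ∈-shifts⁺ p d m p≤i i<m+p with m≤n⇒∃[o]m+o≡n p≤i
  ... | o , refl rewrite +-comm p o = ∈-map⁺ _ (∈-upTo⁺ (+-cancelʳ-< p o m i<m+p))

  length-shifts : ∀ p d m → length (shifts p d m) ≡ m
  length-shifts p d m = trans (length-map _ (upTo m)) (length-upTo m)

  -- The graph has `3 + x + p` vertices, and an edge of length `d` from `i` needs `d + i` below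
  -- that. This leaves `2 + x + p` starts for length 1 and, as longer edges start at `p` or later,
  -- `1 + x` and `x` starts for lengths 2 and 3.
  edgeList : ℕ → ℕ → List (ℕ × ℕ)
  edgeList p x = shifts 0 1 (2 + x + p) ++ shifts p 2 (1 + x) ++ shifts p 3 x

  shifts-disjoint : ∀ d d′ {p q m m′} → d ≢ d′ → Disjoint (shifts p d m) (shifts q d′ m′)
  shifts-disjoint d d′ {p} {q} {m} {m′} d≢d′ {i , _} (e , e′)
    with ∈-shifts⁻ p d m e | ∈-shifts⁻ q d′ m′ e′
  ... | _ , _ , eq | _ , _ , eq′ = d≢d′ (+-cancelʳ-≡ i d d′ (trans (sym eq) eq′))

  edgeList-unique : ∀ p x → Unique (edgeList p x)
  edgeList-unique p x = Unique.++⁺ (shifts-unique 0 1 (2 + x + p))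
    (Unique.++⁺ (shifts-unique p 2 (1 + x)) (shifts-unique p 3 x)
      (shifts-disjoint 2 3 {m = 1 + x} {m′ = x} λ ()))
    λ (e , e′) → case-++ e (∈-++⁻ (shifts p 2 (1 + x)) e′)
    where
    case-++ : ∀ {e} → e ∈ shifts 0 1 (2 + x + p) → e ∈ shifts p 2 (1 + x) ⊎ e ∈ shifts p 3 x → ⊥
    case-++ e₁ (inj₁ e₂) = shifts-disjoint 1 2 {m = 2 + x + p} {m′ = 1 + x} (λ ()) (e₁ , e₂)
    case-++ e₁ (inj₂ e₃) = shifts-disjoint 1 3 {m = 2 + x + p} {m′ = x} (λ ()) (e₁ , e₃)

  ∈-edgeList⁻ : ∀ p x {i j} → (i , j) ∈ edgeList p x → Near p i j × j < 3 + x + p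
  ∈-edgeList⁻ p x {i} e with ∈-++⁻ (shifts 0 1 (2 + x + p)) e
  ... | inj₁ e₁ with ∈-shifts⁻ 0 1 (2 + x + p) e₁
  ...   | _ , lt , refl = inj₁ refl , s≤s (subst (i <_) (+-identityʳ (2 + x + p)) lt)
  ∈-edgeList⁻ p x e | inj₂ e₂₃ with ∈-++⁻ (shifts p 2 (1 + x)) e₂₃
  ... | inj₁ e₂ with ∈-shifts⁻ p 2 (1 + x) e₂
  ...   | p≤i , lt , refl = inj₂ (p≤i , inj₁ refl) , s≤s (s≤s lt)
  ∈-edgeList⁻ p x e | inj₂ e₂₃ | inj₂ e₃ with ∈-shifts⁻ p 3 x e₃
  ...   | p≤i , lt , refl = inj₂ (p≤i , inj₂ refl) , s≤s (s≤s (s≤s lt))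

  ∈-edgeList⁺ : ∀ p x {i j} → Near p i j → j < 3 + x + p → (i , j) ∈ edgeList p x
  ∈-edgeList⁺ p x {i} (inj₁ refl) (s≤s lt) =
    ∈-++⁺ˡ (∈-shifts⁺ 0 1 (2 + x + p) z≤n (subst (i <_) (sym (+-identityʳ (2 + x + p))) lt))
  ∈-edgeList⁺ p x (inj₂ (p≤i , inj₁ refl)) (s≤s (s≤s lt)) =
    ∈-++⁺ʳ (shifts 0 1 (2 + x + p)) (∈-++⁺ˡ (∈-shifts⁺ p 2 (1 + x) p≤i lt))
  ∈-edgeList⁺ p x (inj₂ (p≤i , inj₂ refl)) (s≤s (s≤s (s≤s lt))) =
    ∈-++⁺ʳ (shifts 0 1 (2 + x + p)) (∈-++⁺ʳ (shifts p 2 (1 + x)) (∈-shifts⁺ p 3 x p≤i lt))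

-- Two duplicate-free lists that include each other have equal length, and the length of `edgeList`
-- is explicit.
tailedCube-edgeCount : ∀ p x →
  edgeCount (tailedCube p (3 + x + p)) ≡ (2 + x + p) + ((1 + x) + x)
tailedCube-edgeCount p x = begin
  length (edges G)                          ≡⟨ length-map ends (edges G) ⟨
  length (map ends (edges G))               ≡⟨ ≤-antisym
    (unique-⊆⇒length-≤ (Unique.map⁺ ends-injective edges-unique) forth)
    (unique-⊆⇒length-≤ (edgeList-unique p x) back) ⟩
  length (edgeList p x)                     ≡⟨ length-++ (shifts 0 1 (2 + x + p)) ⟩
  length (shifts 0 1 (2 + x + p)) + length (shifts p 2 (1 + x) ++ shifts p 3 x)
    ≡⟨ cong₂ _+_ (length-shifts 0 1 (2 + x + p)) (trans (length-++ (shifts p 2 (1 + x)))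
         (cong₂ _+_ (length-shifts p 2 (1 + x)) (length-shifts p 3 x))) ⟩
  (2 + x + p) + ((1 + x) + x)               ∎
  where
  open ≡-Reasoning
  n = 3 + x + p
  G = tailedCube p n
  pairs = cartesianProduct (allFin n) (allFin n)

  ends : Fin n × Fin n → ℕ × ℕ
  ends (u , v) = toℕ u , toℕ v

  ends-injective : ∀ {e e′} → ends e ≡ ends e′ → e ≡ e′
  ends-injective eq = cong₂ _,_ (toℕ-injective (cong proj₁ eq)) (toℕ-injective (cong proj₂ eq))

  edges-unique : Unique (edges G)
  edges-unique = Unique.filter⁺ (isEdge? G) (Unique.cartesianProduct⁺ (Unique.allFin⁺ n) (Unique.allFin⁺ n))

  forth : map ends (edges G) ⊆ edgeList p x
  forth e∈ with ∈-map⁻ ends e∈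
  ... | (u , v) , uv∈ , refl =
    ∈-edgeList⁺ p x (tailedCube-edge⁻ (proj₂ (∈-filter⁻ (isEdge? G) {xs = pairs} uv∈))) (toℕ<n v)

  back : edgeList p x ⊆ map ends (edges G)
  back {i , j} ij∈ with ∈-edgeList⁻ p x ij∈
  ... | near , j<n = subst (_∈ map ends (edges G)) (cong₂ _,_ i≡ j≡)
    (∈-map⁺ ends (∈-filter⁺ (isEdge? G) (∈-cartesianProduct⁺ (∈-allFin _) (∈-allFin _))
      (subst₂ _<_ (sym i≡) (sym j≡) i<j , inj₁ (subst₂ (Near p) (sym i≡) (sym j≡) near))))
    where
    i<j = near⇒< {p} near
    i<n = <-trans i<j j<n
    i≡  = toℕ-fromℕ< i<n
    j≡  = toℕ-fromℕ< j<n

-- Rationals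

*-nonNegative : ∀ {a b} → 0ℚ ℚ.≤ a → 0ℚ ℚ.≤ b → 0ℚ ℚ.≤ a ℚ.* b
*-nonNegative {a} {b} 0≤a 0≤b = ℚ.nonNegative⁻¹ (a ℚ.* b)
  {{ℚ.nonNeg*nonNeg⇒nonNeg a {{ℚ.nonNegative 0≤a}} b {{ℚ.nonNegative 0≤b}}}}

*-positive : ∀ {a b} → 0ℚ ℚ.< a → 0ℚ ℚ.< b → 0ℚ ℚ.< a ℚ.* b
*-positive {a} {b} 0<a 0<b = ℚ.positive⁻¹ (a ℚ.* b)
  {{ℚ.pos*pos⇒pos a {{ℚ.positive 0<a}} b {{ℚ.positive 0<b}}}}

*-cancelˡ-pos : ∀ {r a b} → 0ℚ ℚ.< r → r ℚ.* a ≡ r ℚ.* b → a ≡ b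
*-cancelˡ-pos {r} 0<r eq = ℚ.≤-antisym
  (ℚ.*-cancelˡ-≤-pos r {{ℚ.positive 0<r}} (ℚ.≤-reflexive eq))
  (ℚ.*-cancelˡ-≤-pos r {{ℚ.positive 0<r}} (ℚ.≤-reflexive (sym eq)))

*-zero-pos : ∀ {a r} → 0ℚ ℚ.< r → a ℚ.* r ≡ 0ℚ → a ≡ 0ℚ
*-zero-pos {a} {r} 0<r eq = *-cancelˡ-pos 0<r (trans (ℚ.*-comm r a) (trans eq (sym (ℚ.*-zeroʳ r))))

1-nonNegative : ∀ {t} → t ℚ.≤ 1ℚ → 0ℚ ℚ.≤ 1ℚ ℚ.- t
1-nonNegative {t} t≤1 = subst (ℚ._≤ 1ℚ ℚ.- t) (ℚ.+-inverseʳ t) (ℚ.+-monoˡ-≤ (ℚ.- t) t≤1)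

1-positive : ∀ {t} → t ℚ.< 1ℚ → 0ℚ ℚ.< 1ℚ ℚ.- t
1-positive {t} t<1 = subst (ℚ._< 1ℚ ℚ.- t) (ℚ.+-inverseʳ t) (ℚ.+-monoˡ-< (ℚ.- t) t<1)

1-cancel-≤ : ∀ {t u} → 1ℚ ℚ.- u ℚ.≤ 1ℚ ℚ.- t → t ℚ.≤ u
1-cancel-≤ {t} {u} le = subst₂ ℚ._≤_
  (solve 2 (λ t u → (con 1ℚ :- u) :+ (t :+ u :- con 1ℚ) := t) refl t u)
  (solve 2 (λ t u → (con 1ℚ :- t) :+ (t :+ u :- con 1ℚ) := u) refl t u)
  (ℚ.+-monoˡ-≤ (t ℚ.+ u ℚ.- 1ℚ) le)
  where open +-*-Solver

1-1- : ∀ t → 1ℚ ℚ.- (1ℚ ℚ.- t) ≡ t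
1-1- = solve 1 (λ t → con 1ℚ :- (con 1ℚ :- t) := t) refl
  where open +-*-Solver

1-≡0 : ∀ {t} → 1ℚ ℚ.- t ≡ 0ℚ → t ≡ 1ℚ
1-≡0 {t} eq = trans (sym (1-1- t)) (cong (λ x → 1ℚ ℚ.- x) eq)

1-upper : ∀ {t} → 0ℚ ℚ.≤ t → 1ℚ ℚ.- t ℚ.≤ 1ℚ
1-upper {t} 0≤t = subst (1ℚ ℚ.- t ℚ.≤_) (ℚ.+-identityʳ 1ℚ) (ℚ.+-monoʳ-≤ 1ℚ (ℚ.neg-antimono-≤ 0≤t))

ℚ-≤∧≢⇒< : ∀ {a b} → a ℚ.≤ b → a ≢ b → a ℚ.< b
ℚ-≤∧≢⇒< a≤b a≢b = ℚ.≰⇒> λ b≤a → a≢b (ℚ.≤-antisym a≤b b≤a)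

between-0 : ∀ a b → between 0ℚ a b ≡ a
between-0 (x , y) (x′ , y′) = cong₂ _,_ (line x x′) (line y y′)
  where
  open +-*-Solver
  line : ∀ x x′ → (1ℚ ℚ.- 0ℚ) ℚ.* x ℚ.+ 0ℚ ℚ.* x′ ≡ x
  line = solve 2 (λ x x′ → con (1ℚ ℚ.- 0ℚ) :* x :+ con 0ℚ :* x′ := x) refl

between-1 : ∀ a b → between 1ℚ a b ≡ b
between-1 (x , y) (x′ , y′) = cong₂ _,_ (line x x′) (line y y′)
  where
  open +-*-Solver
  line : ∀ x x′ → (1ℚ ℚ.- 1ℚ) ℚ.* x ℚ.+ 1ℚ ℚ.* x′ ≡ x′
  line = solve 2 (λ x x′ → con (1ℚ ℚ.- 1ℚ) :* x :+ con 1ℚ :* x′ := x′) refl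

-- Two segments joining the same pair of rays, with ends at distances a, b and c, d
-- from the apex, that meet at parameters t and u.
nested-segments : ∀ {a b c d t u} → 0ℚ ℚ.< a → 0ℚ ℚ.< b → 0ℚ ℚ.≤ u → u ℚ.≤ 1ℚ →
  a ℚ.≤ c → b ℚ.≤ d → (1ℚ ℚ.- t) ℚ.* a ≡ (1ℚ ℚ.- u) ℚ.* c → t ℚ.* b ≡ u ℚ.* d → t ≡ u
nested-segments {a} {b} {c} {d} {t} {u} 0<a 0<b 0≤u u≤1 a≤c b≤d eq eq′ = ℚ.≤-antisym
  (1-cancel-≤ {t} {u} $ ℚ.*-cancelʳ-≤-pos a {{ℚ.positive 0<a}} $ ℚ.≤-trans
    (ℚ.*-monoˡ-≤-nonNeg (1ℚ ℚ.- u) {{ℚ.nonNegative (1-nonNegative u≤1)}} a≤c)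
    (ℚ.≤-reflexive (sym eq)))
  (ℚ.*-cancelʳ-≤-pos b {{ℚ.positive 0<b}} $ ℚ.≤-trans
    (ℚ.*-monoˡ-≤-nonNeg u {{ℚ.nonNegative 0≤u}} b≤d) (ℚ.≤-reflexive (sym eq′)))

-- Rays and heights

Ray : Set
Ray = Fin 3

thirdRay : ∀ (s s′ : Ray) → ∃[ z ] z ≢ s × z ≢ s′
thirdRay = toWitness
  {a? = Fin.all? λ s → Fin.all? λ s′ → Fin.any? λ z → ¬? (z Fin.≟ s) ×-dec ¬? (z Fin.≟ s′)} tt

turn : Ray → Ray
turn zero             = suc zero
turn (suc zero)       = suc (suc zero)
turn (suc (suc zero)) = zero

turn≢ : ∀ s → turn s ≢ s
turn≢ zero ()
turn≢ (suc zero) ()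
turn≢ (suc (suc zero)) ()

turn²≢ : ∀ s → turn (turn s) ≢ s
turn²≢ zero ()
turn²≢ (suc zero) ()
turn²≢ (suc (suc zero)) ()

turn³≡ : ∀ s → turn (turn (turn s)) ≡ s
turn³≡ zero = refl
turn³≡ (suc zero) = refl
turn³≡ (suc (suc zero)) = refl

spin : ℕ → Ray
spin zero    = zero
spin (suc n) = turn (spin n)

-- Starting at 1 keeps every vertex off the apex: each site lies on a single ray, and radii can be
-- cancelled.
radius : ℕ → ℚ
radius zero    = 1ℚ
radius (suc n) = 1ℚ ℚ.+ radius n

private
  radius-step : ∀ n → radius n ℚ.< radius (suc n)
  radius-step n = subst (ℚ._< 1ℚ ℚ.+ radius n) (ℚ.+-identityˡ (radius n))
    (ℚ.+-monoˡ-< (radius n) (ℚ.positive⁻¹ 1ℚ))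

radius-mono-≤ : ∀ {i j} → i ≤ j → radius i ℚ.≤ radius j
radius-mono-≤ = go ∘ ≤⇒≤′
  where
  go : ∀ {i j} → i ≤′ j → radius i ℚ.≤ radius j
  go ≤′-refl            = ℚ.≤-refl
  go {j = suc j} (≤′-step le) = ℚ.≤-trans (go le) (ℚ.<⇒≤ (radius-step j))

radius-mono-< : ∀ {i j} → i < j → radius i ℚ.< radius j
radius-mono-< {i} i<j = ℚ.<-≤-trans (radius-step i) (radius-mono-≤ i<j)

radius-positive : ∀ i → 0ℚ ℚ.< radius i
radius-positive i = ℚ.<-≤-trans (ℚ.positive⁻¹ 1ℚ) (radius-mono-≤ {0} {i} z≤n)

radius-cancel-≤ : ∀ {i j} → radius i ℚ.≤ radius j → i ≤ j
radius-cancel-≤ le = ≮⇒≥ λ j<i → ℚ.<-irrefl refl (ℚ.<-≤-trans (radius-mono-< j<i) le)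

radius-injective : ∀ {i j} → radius i ≡ radius j → i ≡ j
radius-injective eq = ≤-antisym
  (radius-cancel-≤ (ℚ.≤-reflexive eq)) (radius-cancel-≤ (ℚ.≤-reflexive (sym eq)))

-- Coordinates with respect to the three rays spanned by (1,0), (0,1), (-1,-1).
-- A point has exactly one nonnegative triple of heights that vanishes somewhere.
Heights : Set
Heights = Ray → ℚ

Reduced : Heights → Set
Reduced h = (∀ z → 0ℚ ℚ.≤ h z) × (∃[ z ] h z ≡ 0ℚ)

-- Abstract, because normal forms of rational expressions are huge.
abstract
  plane : Heights → Point
  plane h = h zero ℚ.- h (suc (suc zero)) , h (suc zero) ℚ.- h (suc (suc zero))

  plane-cong : ∀ {g h} → (∀ z → g z ≡ h z) → plane g ≡ plane h
  plane-cong g≗h = cong₂ _,_ (cong₂ ℚ._-_ (g≗h _) (g≗h _)) (cong₂ ℚ._-_ (g≗h _) (g≗h _))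

  -- The kernel of `plane` is spanned by (1,1,1), so `g` and `h` differ by a constant `δ`. At a zero
  -- of `g`, nonnegativity of `h` gives `δ ≤ 0`; at a zero of `h`, nonnegativity of `g` gives
  -- `δ ≥ 0`.
  plane-injective : ∀ {g h} → Reduced g → Reduced h → plane g ≡ plane h → ∀ z → g z ≡ h z
  plane-injective {g} {h} (0≤g , zg , gz≡0) (0≤h , zh , hz≡0) eq z = begin
    g z           ≡⟨ offset z ⟩
    δ ℚ.+ h z     ≡⟨ cong (ℚ._+ h z) δ≡0 ⟩
    0ℚ ℚ.+ h z    ≡⟨ ℚ.+-identityˡ (h z) ⟩
    h z           ∎
    where
    open ≡-Reasoning
    open +-*-Solver
    z₂ : Ray
    z₂ = suc (suc zero)
    δ : ℚ
    δ = g z₂ ℚ.- h z₂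

    move : ∀ a b c d → a ℚ.- b ≡ c ℚ.- d → a ≡ (b ℚ.- d) ℚ.+ c
    move a b c d eq = begin
      a                         ≡⟨ solve 2 (λ a b → a := (a :- b) :+ b) refl a b ⟩
      (a ℚ.- b) ℚ.+ b           ≡⟨ cong (ℚ._+ b) eq ⟩
      (c ℚ.- d) ℚ.+ b           ≡⟨ solve 3 (λ b c d → (c :- d) :+ b := (b :- d) :+ c) refl b c d ⟩
      (b ℚ.- d) ℚ.+ c           ∎

    offset : ∀ z → g z ≡ δ ℚ.+ h z
    offset zero             = move _ _ _ _ (cong proj₁ eq)
    offset (suc zero)       = move _ _ _ _ (cong proj₂ eq)
    offset (suc (suc zero)) = solve 2 (λ a b → a := (a :- b) :+ b) refl (g z₂) (h z₂)

    δ≡0 : δ ≡ 0ℚ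
    δ≡0 = ℚ.≤-antisym
      (subst₂ ℚ._≤_ (ℚ.+-identityʳ δ) (trans (sym (offset zg)) gz≡0) (ℚ.+-monoʳ-≤ δ (0≤h zg)))
      (subst (0ℚ ℚ.≤_) (trans (offset zh) (trans (cong (δ ℚ.+_) hz≡0) (ℚ.+-identityʳ δ))) (0≤g zh))

  spike : Ray → ℚ → Heights
  spike s r z with z Fin.≟ s
  ... | yes _ = r
  ... | no  _ = 0ℚ

  spike-on : ∀ {s r z} → z ≡ s → spike s r z ≡ r
  spike-on {s} {r} {z} z≡s with z Fin.≟ s
  ... | yes _  = refl
  ... | no z≢s = contradiction z≡s z≢s

  spike-off : ∀ {s r z} → z ≢ s → spike s r z ≡ 0ℚ
  spike-off {s} {r} {z} z≢s with z Fin.≟ s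
  ... | yes z≡s = contradiction z≡s z≢s
  ... | no _    = refl

  spike-nonNegative : ∀ {s r} → 0ℚ ℚ.≤ r → ∀ z → 0ℚ ℚ.≤ spike s r z
  spike-nonNegative {s} 0≤r z with z Fin.≟ s
  ... | yes _ = 0≤r
  ... | no _  = ℚ.≤-refl

  blend : ℚ → Heights → Heights → Heights
  blend t g h z = (1ℚ ℚ.- t) ℚ.* g z ℚ.+ t ℚ.* h z

  plane-blend : ∀ t g h → between t (plane g) (plane h) ≡ plane (blend t g h)
  plane-blend t g h = cong₂ _,_
    (line t (g zero) (g (suc (suc zero))) (h zero) (h (suc (suc zero))))
    (line t (g (suc zero)) (g (suc (suc zero))) (h (suc zero)) (h (suc (suc zero))))
    where
    open +-*-Solver
    line : ∀ t a b c d → (1ℚ ℚ.- t) ℚ.* (a ℚ.- b) ℚ.+ t ℚ.* (c ℚ.- d) ≡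
      ((1ℚ ℚ.- t) ℚ.* a ℚ.+ t ℚ.* c) ℚ.- ((1ℚ ℚ.- t) ℚ.* b ℚ.+ t ℚ.* d)
    line = solve 5 (λ t a b c d → (con 1ℚ :- t) :* (a :- b) :+ t :* (c :- d) :=
      ((con 1ℚ :- t) :* a :+ t :* c) :- ((con 1ℚ :- t) :* b :+ t :* d)) refl

  blend-value : ∀ t g h {z a b} → g z ≡ a → h z ≡ b → blend t g h z ≡ (1ℚ ℚ.- t) ℚ.* a ℚ.+ t ℚ.* b
  blend-value t g h refl refl = refl

  blend-0ʳ : ∀ t g h z → h z ≡ 0ℚ → blend t g h z ≡ (1ℚ ℚ.- t) ℚ.* g z
  blend-0ʳ t g h z eq rewrite eq | ℚ.*-zeroʳ t = ℚ.+-identityʳ _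

  blend-0ˡ : ∀ t g h z → g z ≡ 0ℚ → blend t g h z ≡ t ℚ.* h z
  blend-0ˡ t g h z eq rewrite eq | ℚ.*-zeroʳ (1ℚ ℚ.- t) = ℚ.+-identityˡ _

  blend-nonNegative : ∀ {t g h} → 0ℚ ℚ.≤ t → t ℚ.≤ 1ℚ → (∀ z → 0ℚ ℚ.≤ g z) → (∀ z → 0ℚ ℚ.≤ h z) →
    ∀ z → 0ℚ ℚ.≤ blend t g h z
  blend-nonNegative {t} 0≤t t≤1 0≤g 0≤h z =
    ℚ.+-mono-≤ (*-nonNegative (1-nonNegative t≤1) (0≤g z)) (*-nonNegative 0≤t (0≤h z))

private
  blend-self : ∀ t a → (1ℚ ℚ.- t) ℚ.* a ℚ.+ t ℚ.* a ≡ a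
  blend-self = solve 2 (λ t a → (con 1ℚ :- t) :* a :+ t :* a := a) refl
    where open +-*-Solver

blend-lower : ∀ {t a b} → 0ℚ ℚ.≤ t → a ℚ.≤ b → a ℚ.≤ (1ℚ ℚ.- t) ℚ.* a ℚ.+ t ℚ.* b
blend-lower {t} {a} {b} 0≤t a≤b = subst (ℚ._≤ (1ℚ ℚ.- t) ℚ.* a ℚ.+ t ℚ.* b) (blend-self t a)
  (ℚ.+-monoʳ-≤ ((1ℚ ℚ.- t) ℚ.* a) (ℚ.*-monoˡ-≤-nonNeg t {{ℚ.nonNegative 0≤t}} a≤b))

blend-upper : ∀ {t a b} → t ℚ.≤ 1ℚ → a ℚ.≤ b → (1ℚ ℚ.- t) ℚ.* a ℚ.+ t ℚ.* b ℚ.≤ b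
blend-upper {t} {a} {b} t≤1 a≤b = subst ((1ℚ ℚ.- t) ℚ.* a ℚ.+ t ℚ.* b ℚ.≤_) (blend-self t b)
  (ℚ.+-monoˡ-≤ (t ℚ.* b) (ℚ.*-monoˡ-≤-nonNeg (1ℚ ℚ.- t) {{ℚ.nonNegative (1-nonNegative t≤1)}} a≤b))

-- The drawing

module Drawing (p : ℕ) where

  ray : ℕ → Ray
  ray i = spin (i ∸ p)

  height : ℕ → Heights
  height i = spike (ray i) (radius i)

  site : ℕ → Point
  site i = plane (height i)

  -- Combinatorics of the rays: radial edges and chords

  ray-tail : ∀ {i} → i ≤ p → ray i ≡ zero
  ray-tail i≤p rewrite m≤n⇒m∸n≡0 i≤p = refl

  ray-suc : ∀ {i} → p ≤ i → ray (suc i) ≡ turn (ray i)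
  ray-suc p≤i = cong spin (+-∸-assoc 1 p≤i)

  ray-suc² : ∀ {i} → p ≤ i → ray (2 + i) ≡ turn (turn (ray i))
  ray-suc² p≤i = trans (ray-suc (m≤n⇒m≤1+n p≤i)) (cong turn (ray-suc p≤i))

  ray-suc³ : ∀ {i} → p ≤ i → ray (3 + i) ≡ ray i
  ray-suc³ p≤i = trans (ray-suc² (m≤n⇒m≤1+n p≤i)) (trans (cong (turn ∘ turn) (ray-suc p≤i)) (turn³≡ _))

  ray-gap : ∀ {i k} → p ≤ i → i < k → ray k ≡ ray i → 3 + i ≤ k
  ray-gap {i} p≤i i<k eq with m≤n⇒∃[o]m+o≡n i<k
  ... | 0 , refl rewrite +-identityʳ i = contradiction (trans (sym (ray-suc p≤i)) eq) (turn≢ (ray i))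
  ... | 1 , refl rewrite +-comm i 1 = contradiction (trans (sym (ray-suc² p≤i)) eq) (turn²≢ (ray i))
  ... | suc (suc o) , refl rewrite +-comm i (2 + o) = +-monoʳ-≤ 3 (m≤n+m i o)

  -- The rays repeat with period three in the cube, so edges of length 3 stay on a ray and shorter
  -- ones change it; tail edges stay on the first ray. The last clause of `Radial` makes the ends
  -- consecutive on their ray, which is what separates radial edges from one another and from other
  -- vertices.
  Radial Chord : ℕ → ℕ → Set
  Radial i j = i < j × ray i ≡ ray j × (∀ k → i < k → ray k ≡ ray i → j ≤ k)
  Chord i j  = p ≤ i × (j ≡ 1 + i ⊎ j ≡ 2 + i)

  near⇒radial⊎chord : ∀ {i j} → Near p i j → Radial i j ⊎ Chord i j
  near⇒radial⊎chord {i} (inj₁ refl) with ≤-<-connex p i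
  ... | inj₁ p≤i = inj₂ (p≤i , inj₁ refl)
  ... | inj₂ i<p = inj₁ (≤-refl , trans (ray-tail (<⇒≤ i<p)) (sym (ray-tail i<p)) , λ _ i<k _ → i<k)
  near⇒radial⊎chord (inj₂ (p≤i , inj₁ refl)) = inj₂ (p≤i , inj₂ refl)
  near⇒radial⊎chord (inj₂ (p≤i , inj₂ refl)) =
    inj₁ (m≤n⇒m≤1+n (n≤1+n _) , sym (ray-suc³ p≤i) , λ _ → ray-gap p≤i)

  chord-rays : ∀ {i j} → Chord i j → ray i ≢ ray j
  chord-rays (p≤i , inj₁ refl) eq = turn≢ _ (trans (sym (ray-suc p≤i)) (sym eq))
  chord-rays (p≤i , inj₂ refl) eq = turn²≢ _ (trans (sym (ray-suc² p≤i)) (sym eq))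

  -- The order of ends that `nested-segments` asks for, in either of its two directions: `a`, `c` on
  -- one ray and `b`, `d` on another.
  Nested : ℕ → ℕ → ℕ → ℕ → Set
  Nested a b c d = (a ≤ c × b ≤ d) ⊎ (c ≤ a × d ≤ b)

  -- The ordered pair of rays determines the length of a chord, since one turn and two turns never
  -- agree. Chords of equal length are ordered as their starts.
  chords-parallel : ∀ {i j k l} → Chord i j → Chord k l →
    ray k ≡ ray i → ray l ≡ ray j → Nested i j k l
  chords-parallel {i} {j} {k} {l} ij kl = go ij kl
    where
    open ≡-Reasoning
    shift : ∀ d → Nested i (d + i) k (d + k)
    shift d = Sum.map (λ le → le , +-monoʳ-≤ d le) (λ le → le , +-monoʳ-≤ d le) (≤-total i k)
    go : ∀ {j l} → Chord i j → Chord k l → ray k ≡ ray i → ray l ≡ ray j → Nested i j k l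
    go (p≤i , inj₁ refl) (p≤k , inj₁ refl) _ _ = shift 1
    go (p≤i , inj₂ refl) (p≤k , inj₂ refl) _ _ = shift 2
    go (p≤i , inj₁ refl) (p≤k , inj₂ refl) eq eq′ = contradiction
      (begin
        turn (turn (ray i))   ≡⟨ cong (turn ∘ turn) eq ⟨
        turn (turn (ray k))   ≡⟨ ray-suc² p≤k ⟨
        ray (2 + k)           ≡⟨ eq′ ⟩
        ray (1 + i)           ≡⟨ ray-suc p≤i ⟩
        turn (ray i)          ∎)
      (turn≢ _)
    go (p≤i , inj₂ refl) (p≤k , inj₁ refl) eq eq′ = contradiction
      (begin
        turn (turn (ray i))   ≡⟨ ray-suc² p≤i ⟨
        ray (2 + i)           ≡⟨ eq′ ⟨
        ray (1 + k)           ≡⟨ ray-suc p≤k ⟩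
        turn (ray k)          ≡⟨ cong turn eq ⟩
        turn (ray i)          ∎)
      (turn≢ _)

  -- Going there and back is a whole number of rounds, so the lengths are 1 and 2 in some order. If
  -- `i < l`, these vertices of one ray are at least three apart by `ray-gap`; three is the sum of
  -- the two lengths, whence `j ≤ k`.
  chords-antiparallel : ∀ {i j k l} → Chord i j → Chord k l →
    ray k ≡ ray j → ray l ≡ ray i → Nested i j l k
  chords-antiparallel {i} {j} {k} {l} = go
    where
    open ≡-Reasoning
    go : ∀ {j l} → Chord i j → Chord k l → ray k ≡ ray j → ray l ≡ ray i → Nested i j l k
    go (p≤i , inj₁ refl) (p≤k , inj₁ refl) eq eq′ = contradiction
      (begin
        turn (turn (ray i))   ≡⟨ cong turn (ray-suc p≤i) ⟨
        turn (ray (1 + i))    ≡⟨ cong turn eq ⟨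
        turn (ray k)          ≡⟨ ray-suc p≤k ⟨
        ray (1 + k)           ≡⟨ eq′ ⟩
        ray i                 ∎)
      (turn²≢ _)
    go (p≤i , inj₂ refl) (p≤k , inj₂ refl) eq eq′ = contradiction
      (begin
        turn (ray i)                         ≡⟨ turn³≡ (turn (ray i)) ⟨
        turn (turn (turn (turn (ray i))))    ≡⟨ cong (turn ∘ turn) (ray-suc² p≤i) ⟨
        turn (turn (ray (2 + i)))            ≡⟨ cong (turn ∘ turn) eq ⟨
        turn (turn (ray k))                  ≡⟨ ray-suc² p≤k ⟨
        ray (2 + k)                          ≡⟨ eq′ ⟩
        ray i                                ∎)
      (turn≢ _)
    go (p≤i , inj₁ refl) (p≤k , inj₂ refl) eq eq′ with ≤-<-connex (2 + k) i
    ... | inj₁ l≤i = inj₂ (l≤i , m≤n⇒m≤1+n (<⇒≤ (<⇒≤ l≤i)))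
    ... | inj₂ i<l = inj₁ (<⇒≤ i<l , ≤-pred (≤-pred (ray-gap p≤i i<l eq′)))
    go (p≤i , inj₂ refl) (p≤k , inj₁ refl) eq eq′ with ≤-<-connex (1 + k) i
    ... | inj₁ l≤i = inj₂ (l≤i , m≤n⇒m≤1+n (m≤n⇒m≤1+n (<⇒≤ l≤i)))
    ... | inj₂ i<l = inj₁ (<⇒≤ i<l , ≤-pred (ray-gap p≤i i<l eq′))

  -- Heights of vertices and of points on edges

  height-nonNegative : ∀ i z → 0ℚ ℚ.≤ height i z
  height-nonNegative i = spike-nonNegative {ray i} (ℚ.<⇒≤ (radius-positive i))

  height-reduced : ∀ i → Reduced (height i)
  height-reduced i with thirdRay (ray i) (ray i)
  ... | z , z≢ , _ = height-nonNegative i , z , spike-off z≢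

  site-injective : ∀ {i j} → site i ≡ site j → i ≡ j
  site-injective {i} {j} eq = go (ray i Fin.≟ ray j)
    where
    value : radius i ≡ height j (ray i)
    value = trans (sym (spike-on refl))
      (plane-injective (height-reduced i) (height-reduced j) eq (ray i))

    go : Dec (ray i ≡ ray j) → i ≡ j
    go (yes same) = radius-injective (trans value (spike-on same))
    go (no diff)  = contradiction (sym (trans value (spike-off diff))) (ℚ.<⇒≢ (radius-positive i))

  seg : ℚ → ℕ → ℕ → Heights
  seg t i j = blend t (height i) (height j)

  seg-off : ∀ t i j {z} → z ≢ ray i → z ≢ ray j → seg t i j z ≡ 0ℚ
  seg-off t i j {z} ≢i ≢j = trans (blend-0ʳ t (height i) (height j) z (spike-off ≢j))
    (trans (cong ((1ℚ ℚ.- t) ℚ.*_) (spike-off ≢i)) (ℚ.*-zeroʳ (1ℚ ℚ.- t)))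

  seg-start : ∀ t i j {z} → z ≡ ray i → z ≢ ray j → seg t i j z ≡ (1ℚ ℚ.- t) ℚ.* radius i
  seg-start t i j {z} ≡i ≢j = trans (blend-0ʳ t (height i) (height j) z (spike-off ≢j))
    (cong ((1ℚ ℚ.- t) ℚ.*_) (spike-on ≡i))

  seg-end : ∀ t i j {z} → z ≢ ray i → z ≡ ray j → seg t i j z ≡ t ℚ.* radius j
  seg-end t i j {z} ≢i ≡j = trans (blend-0ˡ t (height i) (height j) z (spike-off ≢i))
    (cong (t ℚ.*_) (spike-on ≡j))

  seg-both : ∀ t i j {z} → z ≡ ray i → z ≡ ray j → seg t i j z ≡ (1ℚ ℚ.- t) ℚ.* radius i ℚ.+ t ℚ.* radius j
  seg-both t i j ≡i ≡j = blend-value t (height i) (height j) (spike-on ≡i) (spike-on ≡j)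

  -- The ends occupy at most two rays, and a remaining ray has height zero along the whole segment.
  -- This makes `plane-injective` available at every point of an edge.
  seg-reduced : ∀ {t} i j → 0ℚ ℚ.≤ t → t ℚ.≤ 1ℚ → Reduced (seg t i j)
  seg-reduced {t} i j 0≤t t≤1 with thirdRay (ray i) (ray j)
  ... | z , ≢i , ≢j =
    blend-nonNegative 0≤t t≤1 (height-nonNegative i) (height-nonNegative j) , z , seg-off t i j ≢i ≢j

  record On (i j : ℕ) (P : Point) : Set where
    constructor on
    field
      t   : ℚ
      0≤t : 0ℚ ℚ.≤ t
      t≤1 : t ℚ.≤ 1ℚ
      at  : P ≡ plane (seg t i j)

    heights : Heights
    heights = seg t i j

    reduced : Reduced heights
    reduced = seg-reduced i j 0≤t t≤1

  onSegment⇒on : ∀ {i j P} → OnSegment (site i) (site j) P → On i j P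
  onSegment⇒on {i} {j} (t , 0≤t , t≤1 , eq) = on t 0≤t t≤1 (trans eq (plane-blend t (height i) (height j)))

  End : ℕ → ℕ → Point → Set
  End i j P = P ≡ site i ⊎ P ≡ site j

  module _ {i j P} (o : On i j P) where
    open On o

    t≡0⇒start : t ≡ 0ℚ → P ≡ site i
    t≡0⇒start refl = trans at (trans (sym (plane-blend t (height i) (height j))) (between-0 (site i) (site j)))

    t≡1⇒end : t ≡ 1ℚ → P ≡ site j
    t≡1⇒end refl = trans at (trans (sym (plane-blend t (height i) (height j))) (between-1 (site i) (site j)))

    -- The ends lie on different rays, so one of them is off `s`. The height on that ray vanishes,
    -- which pushes the parameter to the opposite end.
    chord-on-ray : Chord i j → ∀ s → (∀ {z} → z ≢ s → heights z ≡ 0ℚ) → End i j P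
    chord-on-ray ij s off with ray i Fin.≟ s
    ... | no i≢s = inj₂ (t≡1⇒end (1-≡0 (*-zero-pos (radius-positive i)
      (trans (sym (seg-start t i j refl (chord-rays ij))) (off i≢s)))))
    ... | yes i≡s = inj₁ (t≡0⇒start (*-zero-pos (radius-positive j)
      (trans (sym (seg-end t i j j≢i refl)) (off λ j≡s → j≢i (trans j≡s (sym i≡s))))))
      where j≢i = λ eq → chord-rays ij (sym eq)

    module _ (ij : Radial i j) where
      private
        i<j  = proj₁ ij
        same = proj₁ (proj₂ ij)
        r≤r  = radius-mono-≤ (<⇒≤ i<j)

      radial-off : ∀ {z} → z ≢ ray i → heights z ≡ 0ℚ
      radial-off ≢i = seg-off t i j ≢i (λ ≡j → ≢i (trans ≡j (sym same)))

      radial-lower : radius i ℚ.≤ heights (ray i)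
      radial-lower = subst (radius i ℚ.≤_) (sym (seg-both t i j refl same)) (blend-lower 0≤t r≤r)

      radial-upper : heights (ray i) ℚ.≤ radius j
      radial-upper = subst (ℚ._≤ radius j) (sym (seg-both t i j refl same)) (blend-upper t≤1 r≤r)

      radial-site : ∀ {w} → ray w ≡ ray i → heights (ray i) ≡ radius w → P ≡ site w
      radial-site {w} w≡i eq = trans at (plane-cong λ z → agreeAt z (z Fin.≟ ray i))
        where
        agreeAt : ∀ z → Dec (z ≡ ray i) → heights z ≡ height w z
        agreeAt z (yes z≡i) = trans (cong heights z≡i) (trans eq (sym (spike-on (trans z≡i (sym w≡i)))))
        agreeAt z (no z≢i)  = trans (radial-off z≢i) (sym (spike-off λ z≡w → z≢i (trans z≡w w≡i)))

    site-heights : ∀ {w} → P ≡ site w → ∀ z → heights z ≡ height w z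
    site-heights {w} P≡w = plane-injective reduced (height-reduced w) (trans (sym at) P≡w)

    -- A site on another ray has a positive height where the edge has none. On the same ray the
    -- heights give `i ≤ w ≤ j`, and `gap` leaves only the two ends.
    vertex-on-radial : Radial i j → ∀ w → P ≡ site w → Dec (ray w ≡ ray i) → w ≡ i ⊎ w ≡ j
    vertex-on-radial ij w P≡w (no w≢i) = contradiction
      (trans (sym (radial-off ij w≢i)) (trans (site-heights P≡w (ray w)) (spike-on refl)))
      (ℚ.<⇒≢ (radius-positive w))
    vertex-on-radial ij@(_ , _ , gap) w P≡w (yes w≡i) =
      Sum.map sym (λ i<w → ≤-antisym w≤j (gap w i<w w≡i)) (Sum.swap (m≤n⇒m<n∨m≡n i≤w))
      where
      value : heights (ray i) ≡ radius w
      value = trans (site-heights P≡w (ray i)) (spike-on (sym w≡i))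
      i≤w : i ≤ w
      i≤w = radius-cancel-≤ (subst (radius i ℚ.≤_) value (radial-lower ij))
      w≤j : w ≤ j
      w≤j = radius-cancel-≤ (subst (ℚ._≤ radius j) value (radial-upper ij))

    vertex-on-edge : Near p i j → ∀ w → P ≡ site w → End i j P
    vertex-on-edge near w P≡w = [ radial , chord ]′ (near⇒radial⊎chord near)
      where
      radial : Radial i j → End i j P
      radial ij = Sum.map (trans P≡w ∘ cong site) (trans P≡w ∘ cong site)
        (vertex-on-radial ij w P≡w (ray w Fin.≟ ray i))
      chord : Chord i j → End i j P
      chord ij = chord-on-ray ij (ray w) λ {z} z≢w → trans (site-heights P≡w z) (spike-off z≢w)

  -- Common points of two edges

  module _ {i j k l P} (o : On i j P) (o′ : On k l P) where
    private
      module O  = On o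
      module O′ = On o′

    heights-agree : ∀ z → O.heights z ≡ O′.heights z
    heights-agree = plane-injective O.reduced O′.reduced (trans (sym O.at) O′.at)

    radials-cross : Radial i j → Radial k l → Dec (ray i ≡ ray k) → End i j P ⊎ (i ≡ k × j ≡ l)
    radials-cross ij kl (no i≢k) = contradiction
      (ℚ.<-≤-trans (radius-positive i) (ℚ.≤-trans (radial-lower o ij)
        (ℚ.≤-reflexive (trans (heights-agree (ray i)) (radial-off o′ kl i≢k)))))
      (ℚ.<-irrefl refl)
    radials-cross ij@(i<j , i≡j , gap) kl@(k<l , k≡l , gap′) (yes i≡k) = go (<-cmp i k)
      where
      agree : O.heights (ray i) ≡ O′.heights (ray k)
      agree = trans (heights-agree (ray i)) (cong O′.heights i≡k)
      go : Tri (i < k) (i ≡ k) (k < i) → End i j P ⊎ (i ≡ k × j ≡ l)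
      go (tri≈ _ i=k _) = inj₂ (i=k , ≤-antisym
        (gap l (subst (_< l) (sym i=k) k<l) (trans (sym k≡l) (sym i≡k)))
        (gap′ j (subst (_< j) i=k i<j) (trans (sym i≡j) i≡k)))
      -- Here `gap` gives `j ≤ k`: the first edge ends no later than the second begins, so the
      -- common height is squeezed to `radius j`.
      go (tri< i<k _ _) = inj₁ (inj₂ (radial-site o ij (sym i≡j) (ℚ.≤-antisym
        (radial-upper o ij)
        (ℚ.≤-trans (radius-mono-≤ (gap k i<k (sym i≡k)))
          (ℚ.≤-trans (radial-lower o′ kl) (ℚ.≤-reflexive (sym agree)))))))
      go (tri> _ _ k<i) = inj₁ (inj₁ (radial-site o ij refl (ℚ.≤-antisym
        (ℚ.≤-trans (ℚ.≤-reflexive agree)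
          (ℚ.≤-trans (radial-upper o′ kl) (radius-mono-≤ (gap′ i k<i i≡k))))
        (radial-lower o ij))))

    -- An interior point of a chord has positive height on both of its rays, so the second chord
    -- joins the same two rays. The chords are then nested, and `nested-segments` forces equal
    -- parameters, hence equal ends.
    chords-cross : Chord i j → Chord k l → 0ℚ ℚ.< O.t → O.t ℚ.< 1ℚ → i ≡ k × j ≡ l
    chords-cross ij kl 0<t t<1 = go (met (ray i) start-positive) (met (ray j) end-positive)
      where
      i≢j = chord-rays ij
      k≢l = chord-rays kl
      0<1-t = 1-positive t<1
      start-value = seg-start O.t i j {ray i} refl i≢j
      end-value   = seg-end O.t i j {ray j} (i≢j ∘ sym) refl

      start-positive : 0ℚ ℚ.< O.heights (ray i)
      start-positive = subst (0ℚ ℚ.<_) (sym start-value) (*-positive 0<1-t (radius-positive i))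

      end-positive : 0ℚ ℚ.< O.heights (ray j)
      end-positive = subst (0ℚ ℚ.<_) (sym end-value) (*-positive 0<t (radius-positive j))

      met : ∀ z → 0ℚ ℚ.< O.heights z → z ≡ ray k ⊎ z ≡ ray l
      met z 0<h with z Fin.≟ ray k | z Fin.≟ ray l
      ... | yes z≡k | _       = inj₁ z≡k
      ... | no _    | yes z≡l = inj₂ z≡l
      ... | no z≢k  | no z≢l  = contradiction
        (subst (0ℚ ℚ.<_) (trans (heights-agree z) (seg-off O′.t k l z≢k z≢l)) 0<h) (ℚ.<-irrefl refl)

      coincide : ∀ {a b u} → 0ℚ ℚ.≤ u → u ℚ.≤ 1ℚ → Nested i j a b →
        (1ℚ ℚ.- O.t) ℚ.* radius i ≡ (1ℚ ℚ.- u) ℚ.* radius a →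
        O.t ℚ.* radius j ≡ u ℚ.* radius b → i ≡ a × j ≡ b
      coincide {a} {b} {u} 0≤u u≤1 nested eq eq′ =
        radius-injective (*-cancelˡ-pos 0<1-t
          (trans eq (cong (λ t → (1ℚ ℚ.- t) ℚ.* radius a) (sym (t≡u nested))))) ,
        radius-injective (*-cancelˡ-pos 0<t (trans eq′ (cong (ℚ._* radius b) (sym (t≡u nested)))))
        where
        t≡u : Nested i j a b → O.t ≡ u
        t≡u (inj₁ (i≤a , j≤b)) = nested-segments (radius-positive i) (radius-positive j) 0≤u u≤1
          (radius-mono-≤ i≤a) (radius-mono-≤ j≤b) eq eq′
        t≡u (inj₂ (a≤i , b≤j)) = sym (nested-segments (radius-positive a) (radius-positive b) O.0≤t O.t≤1
          (radius-mono-≤ a≤i) (radius-mono-≤ b≤j) (sym eq) (sym eq′))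

      go : ray i ≡ ray k ⊎ ray i ≡ ray l → ray j ≡ ray k ⊎ ray j ≡ ray l → i ≡ k × j ≡ l
      go (inj₁ i≡k) (inj₁ j≡k) = contradiction (trans i≡k (sym j≡k)) i≢j
      go (inj₂ i≡l) (inj₂ j≡l) = contradiction (trans i≡l (sym j≡l)) i≢j
      go (inj₁ i≡k) (inj₂ j≡l) = coincide O′.0≤t O′.t≤1
        (chords-parallel ij kl (sym i≡k) (sym j≡l))
        (trans (sym start-value) (trans (heights-agree (ray i))
          (seg-start O′.t k l i≡k (λ i≡l → i≢j (trans i≡l (sym j≡l))))))
        (trans (sym end-value) (trans (heights-agree (ray j))
          (seg-end O′.t k l (λ j≡k → i≢j (trans i≡k (sym j≡k))) j≡l)))
      -- The second chord is traversed backwards, with parameter `1 - O′.t`. Coincidence would mean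
      -- `i ≡ l` and `j ≡ k`, although both chords run from the smaller to the larger vertex.
      go (inj₂ i≡l) (inj₁ j≡k) = contradiction
        (<-trans (chord-< ij) (subst₂ _<_ (sym (proj₂ both)) (sym (proj₁ both)) (chord-< kl)))
        (<-irrefl refl)
        where
        chord-< : ∀ {i j} → Chord i j → i < j
        chord-< (_ , inj₁ refl) = ≤-refl
        chord-< (_ , inj₂ refl) = n≤1+n _

        both : i ≡ l × j ≡ k
        both = coincide {l} {k} {1ℚ ℚ.- O′.t} (1-nonNegative O′.t≤1) (1-upper O′.0≤t)
          (chords-antiparallel ij kl (sym j≡k) (sym i≡l))
          (trans (sym start-value) (trans (heights-agree (ray i)) (trans
            (seg-end O′.t k l (λ i≡k → i≢j (trans i≡k (sym j≡k))) i≡l)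
            (cong (ℚ._* radius l) (sym (1-1- O′.t))))))
          (trans (sym end-value) (trans (heights-agree (ray j))
            (seg-start O′.t k l j≡k (λ j≡l → i≢j (trans i≡l (sym j≡l))))))

  edges-cross : ∀ {i j k l P} → Near p i j → Near p k l → On i j P → On k l P →
    End i j P ⊎ (i ≡ k × j ≡ l)
  edges-cross {i} {j} {k} {l} {P} e e′ o o′ = go (near⇒radial⊎chord e) (near⇒radial⊎chord e′)
    where
    chords : Chord i j → Chord k l → Dec (On.t o ≡ 0ℚ) → Dec (On.t o ≡ 1ℚ) →
      End i j P ⊎ (i ≡ k × j ≡ l)
    chords ij kl (yes t≡0) _         = inj₁ (inj₁ (t≡0⇒start o t≡0))
    chords ij kl (no _)    (yes t≡1) = inj₁ (inj₂ (t≡1⇒end o t≡1))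
    chords ij kl (no t≢0)  (no t≢1)  = inj₂ (chords-cross o o′ ij kl
      (ℚ-≤∧≢⇒< (On.0≤t o) (t≢0 ∘ sym)) (ℚ-≤∧≢⇒< (On.t≤1 o) t≢1))

    go : Radial i j ⊎ Chord i j → Radial k l ⊎ Chord k l → End i j P ⊎ (i ≡ k × j ≡ l)
    go (inj₁ ij) (inj₁ kl) = radials-cross o o′ ij kl (ray i Fin.≟ ray k)
    -- A point of the radial edge lies on one ray, so it is an end of the chord. That end is a
    -- vertex on the radial edge, hence an end of the radial edge too.
    go (inj₁ ij) (inj₂ kl) = inj₁ ([ vertex-on-edge o e k , vertex-on-edge o e l ]′
      (chord-on-ray o′ kl (ray i) λ {z} z≢i → trans (sym (heights-agree o o′ z)) (radial-off o ij z≢i)))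
    go (inj₂ ij) (inj₁ kl) = inj₁ (chord-on-ray o ij (ray k) λ {z} z≢k →
      trans (heights-agree o o′ z) (radial-off o′ kl z≢k))
    go (inj₂ ij) (inj₂ kl) = chords ij kl (On.t o ℚ.≟ 0ℚ) (On.t o ℚ.≟ 1ℚ)

tailedCube-planar : ∀ p n → Planar (tailedCube p n)
tailedCube-planar p n = record
  { position             = site ∘ toℕ
  ; bends                = λ _ → []
  ; positions-distinct   = toℕ-injective ∘ site-injective
  ; edges-arcs           = λ u v e →
      (λ eq → <-irrefl (site-injective eq) (proj₁ e)) , (λ _ _ P≡v → P≡v) , tt
  ; interior-no-vertex   = λ (u , v) e w →
      [ (λ o → vertex-on-edge (onSegment⇒on o) (tailedCube-edge⁻ e) (toℕ w) refl) , inj₂ ]′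
  ; interior-no-crossing = λ (u , v) (u′ , v′) e e′ e≢e′ P → λ
      { (inj₂ end) _ → inj₂ end
      ; (inj₁ o) (inj₂ P≡v′) → vertex-on-edge (onSegment⇒on o) (tailedCube-edge⁻ e) (toℕ v′) P≡v′
      ; (inj₁ o) (inj₁ o′) → [ id , (λ (u≡ , v≡) →
          contradiction (cong₂ _,_ (toℕ-injective u≡) (toℕ-injective v≡)) e≢e′) ]′
          (edges-cross (tailedCube-edge⁻ e) (tailedCube-edge⁻ e′) (onSegment⇒on o) (onSegment⇒on o′)) } }
  where open Drawing p

-- The limit

-- The excess over 1 is `d / b`, at most `1 / k`. A positive rational has numerator at least 1, so
-- it is at least the reciprocal of its denominator; comparing `k` with the denominator of `ε`
-- therefore suffices.
fraction-<-1+ : ∀ {a b d k} .{{_ : NonZero b}} → a ≡ b + d → 0 < d → d * k ≤ b →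
  ∀ {ε} → 0ℚ ℚ.< ε → ↧ₙ ε < k → (+ a) ℚ./ b ℚ.< 1ℚ ℚ.+ ε
fraction-<-1+ {b = b@(suc b′)} {d} {k} refl 0<d dk≤b {ε@(mkℚ +[1+ e ] δ _)} _ δ<k = ℚ.toℚᵘ-cancel-< (begin-strict
  ℚ.toℚᵘ ((+ (b + d)) ℚ./ b)                       ≃⟨ ℚ.toℚᵘ-fromℚᵘ (mkℚᵘ (+ (b + d)) b′) ⟩
  mkℚᵘ (+ (b + d)) b′                              <⟨ *<* (subst₂ ℤ._<_ (ℤ.pos-* (b + d) (1 * suc δ)) rhs (+<+ cross)) ⟩
  ℚᵘ.1ℚᵘ ℚᵘ.+ ℚ.toℚᵘ ε                             ≃⟨ ℚᵘ.≃-sym (ℚ.toℚᵘ-homo-+ 1ℚ ε) ⟩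
  ℚ.toℚᵘ (1ℚ ℚ.+ ε)                                ∎)
  where
  open ℚᵘ.≤-Reasoning
  cross : (b + d) * (1 * suc δ) < (1 * suc δ + suc e * 1) * b
  cross = ≤R.begin-strict
    (b + d) * (1 * suc δ)             ≤R.≡⟨ solve b d (suc δ) ⟩
    suc δ * b + d * suc δ             ≤R.<⟨ +-monoʳ-< (suc δ * b) (*-monoʳ-< d {{>-nonZero 0<d}} δ<k) ⟩
    suc δ * b + d * k                 ≤R.≤⟨ +-monoʳ-≤ (suc δ * b) (≤-trans dk≤b (m≤m+n b (e * b))) ⟩
    suc δ * b + suc e * b             ≤R.≡⟨ solve′ (suc δ) (suc e) b ⟩
    (1 * suc δ + suc e * 1) * b       ≤R.∎
    where
    module ≤R = ≤-Reasoning
    solve : ∀ b d x → (b + d) * (1 * x) ≡ x * b + d * x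
    solve = solve-∀
    solve′ : ∀ x y b → x * b + y * b ≡ (1 * x + y * 1) * b
    solve′ = solve-∀
  rhs : + ((1 * suc δ + suc e * 1) * b) ≡ ((+ 1) ℤ.* (+ suc δ) ℤ.+ (+ suc e) ℤ.* (+ 1)) ℤ.* (+ b)
  rhs = trans (ℤ.pos-* (1 * suc δ + suc e * 1) b) (cong (ℤ._* + b)
    (trans (ℤ.pos-+ (1 * suc δ) (suc e * 1)) (cong₂ ℤ._+_ (ℤ.pos-* 1 (suc δ)) (ℤ.pos-* (suc e) 1))))
fraction-<-1+ _ _ _ {mkℚ (+ zero) δ _} (*<* (+<+ ())) _
fraction-<-1+ _ _ _ {mkℚ ℤ.-[1+ _ ] δ _} (*<* ()) _

1≤fraction : ∀ {a b} .{{_ : NonZero b}} → b ≤ a → 1ℚ ℚ.≤ (+ a) ℚ./ b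
1≤fraction {a} {b@(suc b′)} b≤a = ℚ.toℚᵘ-cancel-≤ (ℚᵘ.≤-respʳ-≃ (ℚᵘ.≃-sym (ℚ.toℚᵘ-fromℚᵘ (mkℚᵘ (+ a) b′)))
  (*≤* (subst₂ ℤ._≤_ (sym (ℤ.*-identityˡ (+ b))) (sym (ℤ.*-identityʳ (+ a))) (+≤+ b≤a))))

fraction-near-1 : ∀ {a b d k} .{{_ : NonZero b}} → a ≡ b + d → 0 < d → d * k ≤ b →
  ∀ {ε} → 0ℚ ℚ.< ε → ↧ₙ ε < k → ℚ.∣ (+ a) ℚ./ b ℚ.- 1ℚ ∣ ℚ.< ε
fraction-near-1 {a} {b} {d} a≡b+d 0<d dk≤b {ε} 0<ε ε<k = begin-strict
  ℚ.∣ r ℚ.- 1ℚ ∣             ≡⟨ ℚ.0≤p⇒∣p∣≡p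
    (ℚ.+-monoˡ-≤ (ℚ.- 1ℚ) (1≤fraction (subst (b ≤_) (sym a≡b+d) (m≤m+n b d)))) ⟩
  r ℚ.- 1ℚ                   <⟨ ℚ.+-monoˡ-< (ℚ.- 1ℚ) (fraction-<-1+ a≡b+d 0<d dk≤b 0<ε ε<k) ⟩
  (1ℚ ℚ.+ ε) ℚ.- 1ℚ          ≡⟨ cong (ℚ._- 1ℚ) (ℚ.+-comm 1ℚ ε) ⟩
  (ε ℚ.+ 1ℚ) ℚ.- 1ℚ          ≡⟨ ℚ.+-assoc ε 1ℚ (ℚ.- 1ℚ) ⟩
  ε ℚ.+ 0ℚ                   ≡⟨ ℚ.+-identityʳ ε ⟩
  ε                          ∎
  where
  open ℚ.≤-Reasoning
  r = (+ a) ℚ./ b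

-- Arithmetic of the balanced graphs

⌊/2⌋-parity : ∀ q → q ≡ ⌊ q /2⌋ + ⌊ q /2⌋ ⊎ q ≡ suc (⌊ q /2⌋ + ⌊ q /2⌋)
⌊/2⌋-parity 0 = inj₁ refl
⌊/2⌋-parity 1 = inj₂ refl
⌊/2⌋-parity (suc (suc q)) with ⌊/2⌋-parity q
... | inj₁ eq = inj₁ (cong suc (trans (cong suc eq) (sym (+-suc _ _))))
... | inj₂ eq = inj₂ (cong suc (cong suc (trans eq (sym (+-suc _ _)))))

-- This brings `n` into the form `3 + x + p` of the edge count, with `x = h * 3` and `p = k * 3`.
-- The alternatives for `k` are the parities of `n / 3`.
halves : ∀ {n} → 6 ≤ n → (3∣n : 3 ∣ n) → let k = ⌊ quotient 3∣n /2⌋ in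
  ∃[ h ] n ≡ 3 + h * 3 + k * 3 × (k ≡ suc h ⊎ k ≡ h)
halves 6≤n (divides q eq) with ⌊ q /2⌋ | ⌊/2⌋-parity q
halves () (divides _ refl) | zero | inj₁ refl
halves 6≤n (divides _ refl) | suc h | inj₁ refl = h , *-distribʳ-+ 3 (suc h) (suc h) , inj₁ refl
halves 6≤n (divides _ refl) | k | inj₂ refl = k , cong (λ x → 3 + x) (*-distribʳ-+ 3 k k) , inj₂ refl

⌈2+3*/3⌉ : ∀ h → ⌈ 2 + h * 3 /3⌉ ≡ suc h
⌈2+3*/3⌉ zero    = refl
⌈2+3*/3⌉ (suc h) = cong suc (⌈2+3*/3⌉ h)

-- Squares are spelled out as x * (x * 1), because the ring solver rejects x ^ 2 here.
gap-even : ∀ h → 4 * ((3 + h * 3 + suc h * 3) * ((3 + h * 3 + suc h * 3) * 1)) ≡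
  3 * ((2 + h * 3 + suc h * 3) + ((1 + h * 3) + h * 3)) * (suc h * 3 + suc h) + 72 * suc h
gap-even = solve-∀

-- With `k = suc h` there are `6k` vertices and `12k - 6` edges, and the diameter is `4k`. The gap
-- is `72k`; multiplied by `k` it leaves the nonnegative remainder `72hk`.
gap-even-≤ : ∀ h → 72 * suc h * suc h + 72 * h * suc h ≡
  3 * ((2 + h * 3 + suc h * 3) + ((1 + h * 3) + h * 3)) * (suc h * 3 + suc h)
gap-even-≤ = solve-∀

-- Here there are `6k + 3` vertices and `12k + 3` edges, and the diameter is `4k + 1`, exactly a
-- third of the edge count. The gap is `36(2k+1)² - 9(4k+1)²`.
gap-odd : ∀ k →
  4 * ((3 + k * 3 + k * 3) * ((3 + k * 3 + k * 3) * 1)) ≡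
  3 * ((2 + k * 3 + k * 3) + ((1 + k * 3) + k * 3)) * (k * 3 + suc k) + 9 * (3 + 8 * k)
gap-odd = solve-∀

gap-odd-≤ : ∀ k → 9 * (3 + 8 * k) * k + 9 * (8 * k * k + 5 * k + 1) ≡
  3 * ((2 + k * 3 + k * 3) + ((1 + k * 3) + k * 3)) * (k * 3 + suc k)
gap-odd-≤ = solve-∀

extremal : ∀ n → 3 ∣ n → ConnectedPlanarGraph n
extremal n 3∣n = record
  { graph     = tailedCube p n
  ; connected = tailedCube-connected
  ; planar    = tailedCube-planar p n }
  -- The largest multiple of 3 not exceeding `n / 2`. Divisibility by 3 makes the rounding in
  -- `level` explicit.
  where p = ⌊ quotient 3∣n /2⌋ * 3

extremal-diameter : ∀ n → 6 ≤ n → (3∣n : 3 ∣ n) →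
  ∃ (IsDiameter (ConnectedPlanarGraph.graph (extremal n 3∣n)))
extremal-diameter (suc n) _ 3∣n = _ , tailedCube-diameter (⌊ quotient 3∣n /2⌋ * 3) n

-- The last three components bound the relative error of `b` against `4n²` by `1 / k`; the first
-- makes `k` grow with `n`.
Gap : ℕ → ℕ → ℕ → Set
Gap n b k = n < 6 * suc k × ∃[ d ] 4 * n ^ 2 ≡ b + d × 0 < d × d * k ≤ b

balanced-gap : ∀ h k → k ≡ suc h ⊎ k ≡ h → let n = 3 + h * 3 + k * 3 in
  Gap n (3 * edgeCount (tailedCube (k * 3) n) * level (k * 3) (2 + h * 3 + k * 3)) k
balanced-gap h k balanced = subst (λ b → Gap (3 + h * 3 + k * 3) b k)
  (cong₂ (λ m D → 3 * m * D) (sym (tailedCube-edgeCount (k * 3) (h * 3)))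
    (sym (trans (level-cube (k * 3) (2 + h * 3)) (cong (λ D → k * 3 + D) (⌈2+3*/3⌉ h)))))
  (go balanced)
  where
  size-even : ∀ h → 5 + suc (3 + h * 3 + suc h * 3) ≡ 6 * suc (suc h)
  size-even = solve-∀

  size-odd : ∀ k → 2 + suc (3 + k * 3 + k * 3) ≡ 6 * suc k
  size-odd = solve-∀

  go : k ≡ suc h ⊎ k ≡ h →
    Gap (3 + h * 3 + k * 3) (3 * ((2 + h * 3 + k * 3) + ((1 + h * 3) + h * 3)) * (k * 3 + suc h)) k
  go (inj₁ refl) = ≤-trans (m≤n+m _ 5) (≤-reflexive (size-even h)) ,
    72 * suc h , gap-even h , s≤s z≤n , ≤-trans (m≤m+n _ _) (≤-reflexive (gap-even-≤ h))
  go (inj₂ refl) = ≤-trans (m≤n+m _ 2) (≤-reflexive (size-odd h)) ,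
    9 * (3 + 8 * h) , gap-odd h , s≤s z≤n , ≤-trans (m≤m+n _ _) (≤-reflexive (gap-odd-≤ h))

extremal-gap : ∀ n (6≤n : 6 ≤ n) (3∣n : 3 ∣ n) →
  Gap n (3 * edgeCount (ConnectedPlanarGraph.graph (extremal n 3∣n)) * proj₁ (extremal-diameter n 6≤n 3∣n))
    ⌊ quotient 3∣n /2⌋
extremal-gap n 6≤n 3∣n@(divides q _) with halves 6≤n 3∣n
... | h , refl , bal = balanced-gap h ⌊ q /2⌋ bal

mainTheorem5 :
    Σ[ G ∈ (∀ n → 6 ≤ n → 3 ∣ n → ConnectedPlanarGraph n) ]
    Σ[ D ∈ (∀ n (6≤n : 6 ≤ n) (3∣n : 3 ∣ n) →
              ∃ (IsDiameter (ConnectedPlanarGraph.graph (G n 6≤n 3∣n)))) ]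
    (∀ (ε : ℚ) → 0ℚ ℚ.< ε →
      ∃[ N ] (∀ n (6≤n : 6 ≤ n) (3∣n : 3 ∣ n) → N ≤ n →
        ℚ.∣ ratio (≤-trans (m≤m+n 2 4) 6≤n) (G n 6≤n 3∣n) (D n 6≤n 3∣n) ℚ.- 1ℚ ∣ ℚ.< ε))
mainTheorem5 = (λ n _ → extremal n) , extremal-diameter , λ ε 0<ε →
  -- Combined with `n < 6 * suc k`, this threshold yields `↧ₙ ε < k`.
  6 * suc (↧ₙ ε) , λ n 6≤n 3∣n N≤n →
  let n<6k , d , a≡b+d , 0<d , dk≤b = extremal-gap n 6≤n 3∣n
      1<n  = ≤-trans (m≤m+n 2 4) 6≤n
      open ConnectedPlanarGraph (extremal n 3∣n)
  in fraction-near-1 {{3mD-nonZero graph 1<n connected (proj₂ (extremal-diameter n 6≤n 3∣n))}}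
       a≡b+d 0<d dk≤b 0<ε (≤-pred (*-cancelˡ-< 6 _ _ (≤-<-trans N≤n n<6k)))
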